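{- There exist a planar graph $G$ and a signature $\sigma: E(G)\to\{1,-1\}$ such that the signed graph $(G,\sigma)$ is not $4$-choosable, but the unsigned graph $G$ is $4$-choosable.
   Context: All graphs are finite and simple. A signed graph is a pair $(G,\sigma)$ where $G$ is a graph and $\sigma: E(G)\to\{1,-1\}$ is a mapping, called a signature of $G$. A proper coloring of $(G,\sigma)$ is a map $c: V(G)\to\mathbb{Z}$ such that $c(u)\neq \sigma(uv)\,c(v)$ for every edge $uv\in E(G)$. A list-assignment is a function $L$ on $V(G)$ with $\emptyset\neq L(v)\subseteq\mathbb{Z}$ for each $v\in V(G)$; it is a $k$-list-assignment if $|L(v)|=k$ for every $v\in V(G)$. An $L$-coloring is a proper coloring $c$ of $(G,\sigma)$ with $c(v)\in L(v)$ for every $v\in V(G)$. $(G,\sigma)$ is $k$-choosable if it has an $L$-coloring for every $k$-list-assignment $L$. The unsigned graph $G$ is $k$-choosable in the usual sense, i.e. for every $k$-list-assignment $L$ there is a map $c$ with $c(v)\in L(v)$ for all $v$ and $c(u)\ne c(v)$ for every edge $uv$ (equivalently, the signed graph with all edges of sign $1$ is $k$-choosable). -}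

module Defs where

open import Data.Bool using (Bool; T)
open import Data.Fin using (Fin; _<_)
open import Data.Integer using (ℤ; _◃_) renaming (_*_ to _*ℤ_)
open import Data.List using (List; []; length)
open import Data.List.Membership.Propositional using (_∈_)
open import Data.List.Relation.Unary.Unique.Propositional using (Unique)
open import Data.Nat using (ℕ)
open import Data.Product using (∃-syntax; _×_; _,_)
open import Data.Rational using (ℚ; 0ℚ; 1ℚ; _+_; _*_; _-_; _≤_)
open import Data.Sign using (Sign)
open import Data.Sum using (_⊎_)
open import Function.Definitions using (Injective)
open import Relation.Binary.PropositionalEquality using (_≡_; _≢_)
open import Relation.Nullary using (¬_)

record Graph : Set where
  field
    order  : ℕ
    adj    : Fin order → Fin order → Bool
    sym    : ∀ u v → T (adj u v) → T (adj v u)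
    irrefl : ∀ v → ¬ T (adj v v)

  Vertex : Set
  Vertex = Fin order

-- An unordered edge uv is represented once, by its orientation with u < v.
record Edge (G : Graph) : Set where
  open Graph G
  field
    src tgt : Vertex
    src<tgt : src < tgt
    isEdge  : T (adj src tgt)

Signature : Graph → Set
Signature G = Edge G → Sign

-- As signs are ±1, c u ≢ σ(uv) c v is symmetric in u and v, so the chosen
-- orientation of the edges is immaterial.  The integer s ◃ 1 is s ∈ {1, -1}.
ProperColoring : (G : Graph) → Signature G → (Graph.Vertex G → ℤ) → Set
ProperColoring G σ c = ∀ (e : Edge G) → let open Edge e in
  c src ≢ (σ e ◃ 1) *ℤ c tgt

UnsignedProperColoring : (G : Graph) → (Graph.Vertex G → ℤ) → Set
UnsignedProperColoring G c = ∀ (e : Edge G) → let open Edge e in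
  c src ≢ c tgt

-- Finite sets of integers are duplicate-free lists.
record ListAssignment (G : Graph) : Set where
  open Graph G
  field
    list     : Vertex → List ℤ
    unique   : ∀ v → Unique (list v)
    nonempty : ∀ v → list v ≢ []

IsKListAssignment : (G : Graph) → ℕ → ListAssignment G → Set
IsKListAssignment G k L = ∀ v → length (ListAssignment.list L v) ≡ k

FromLists : (G : Graph) → ListAssignment G → (Graph.Vertex G → ℤ) → Set
FromLists G L c = ∀ v → c v ∈ ListAssignment.list L v

SignedChoosable : (G : Graph) → Signature G → ℕ → Set
SignedChoosable G σ k = (L : ListAssignment G) → IsKListAssignment G k L →
  ∃[ c ] (ProperColoring G σ c × FromLists G L c)

Choosable : Graph → ℕ → Set
Choosable G k = (L : ListAssignment G) → IsKListAssignment G k L →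
  ∃[ c ] (UnsignedProperColoring G c × FromLists G L c)

-- Planarity is the existence of a drawing in the plane whose edges are
-- polygonal arcs.  All corners are rational, which loses no planar graph: the
-- corners of a polygonal drawing can be perturbed to rational points.  Two
-- segments with rational ends that meet in ℝ² also meet in ℚ², and if they
-- share a second real point, they share a second rational one; hence the
-- conditions below, on rational points, hold for all real points as well.
Point : Set
Point = ℚ × ℚ

_∈[_,_] : Point → Point → Point → Set
(x , y) ∈[ (x₀ , y₀) , (x₁ , y₁) ] = ∃[ t ]
  ( 0ℚ ≤ t × t ≤ 1ℚ
  × x ≡ (1ℚ - t) * x₀ + t * x₁
  × y ≡ (1ℚ - t) * y₀ + t * y₁ )

data Polyline : Point → Point → Set where
  segment : ∀ p q → Polyline p q
  _∷_     : ∀ p {q r} → Polyline q r → Polyline p r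

_on_ : ∀ {p q} → Point → Polyline p q → Set
x on segment p q   = x ∈[ p , q ]
x on (_∷_ p {q} l) = x ∈[ p , q ] ⊎ x on l

-- The polyline is homeomorphic to [0,1].
IsArc : ∀ {p q} → Polyline p q → Set
IsArc (segment p q) = p ≢ q
IsArc (_∷_ p {q} l) =
  p ≢ q × IsArc l × (∀ x → x ∈[ p , q ] → x on l → x ≡ q)

record PlaneDrawing (G : Graph) : Set where
  open Graph G
  open Edge
  field
    pos     : Vertex → Point
    pos-inj : Injective _≡_ _≡_ pos
    arc     : (e : Edge G) → Polyline (pos (src e)) (pos (tgt e))
    isArc   : ∀ e → IsArc (arc e)

  Interior : Edge G → Point → Set
  Interior e x = x on arc e × x ≢ pos (src e) × x ≢ pos (tgt e)

  field
    no-vertex-inside : ∀ e v → ¬ Interior e (pos v)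
    no-crossing      : ∀ e f → e ≢ f → ∀ x → Interior e x → ¬ (x on arc f)

Planar : Graph → Set
Planar = PlaneDrawing

{-# OPTIONS --safe #-}
module Submission where

-- G consists of two nonadjacent vertices top and bot and of 16 gadgets, one for each pair (a , b) of
-- colours in disjoint lists of top and bot.  In a gadget, r₁ and r₂ are adjacent to top and bot;
-- u₁ v₁ w₁ is a triangle forming an octahedron with top, bot, r₁ (and likewise u₂ v₂ w₂); and
-- s₁ s₂ s₃ s₄ is a 4-cycle forming an antiprism with the 4-cycle top r₁ bot r₂.  Only s₁s₂ is negative.
--
-- Signed: if top and bot have the colours a and b of a gadget, its octahedra force r₁ and r₂ to
-- the colour 11, which leaves {9 , -9} on the unbalanced cycle s₁ s₂ s₃ s₄: no colouring exists.
--
-- Unsigned: colour top and bot arbitrarily.  For each r at least two colours remain, and its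
-- octahedron rules out at most one of them.  Then every s has two colours left, and even cycles
-- are 2-choosable.

open import Data.Bool using (Bool; T; _∨_)
open import Data.Bool.Properties using (T-∨; T-irrelevant)
open import Data.Fin as Fin using (Fin; zero; suc; toℕ; _↑ʳ_; combine; remQuot)
import Data.Fin.Properties as Fin
open import Data.Integer as ℤ using (ℤ; 0ℤ; +_)
import Data.Integer.Properties as ℤ
open import Data.List as List using (List; []; _∷_; length; allFin; cartesianProduct; cartesianProductWith)
open import Data.List.Membership.Propositional using (_∈_; _∉_; find; lose)
open import Data.List.Membership.Propositional.Properties using (∈-cartesianProduct⁺; ∈-cartesianProductWith⁺; ∈-cartesianProductWith⁻; ∈-allFin; ∈-lookup)
import Data.List.Membership.DecPropositional as DecMembership
open import Data.List.Relation.Unary.All as All using (All; []; _∷_)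
open import Data.List.Relation.Unary.AllPairs using ([]; _∷_)
open import Data.List.Relation.Unary.Any as Any using (Any; here; there)
open import Data.List.Relation.Unary.Any.Properties using (lookup-index)
open import Data.List.Relation.Unary.Unique.Propositional using (Unique)
import Data.List.Relation.Unary.Unique.DecPropositional as DecUnique
open import Data.Nat as ℕ using (ℕ; s≤s; z≤n)
import Data.Nat.Properties as ℕ
open import Data.Product using (Σ; ∃; ∃₂; _×_; _,_; proj₁; proj₂; uncurry; map₂)
open import Data.Product.Properties using (≡-dec)
open import Data.Rational as ℚ using (ℚ; 0ℚ; 1ℚ)
import Data.Rational.Properties as ℚ
open import Data.Rational.Literals using (fromℤ)
open import Data.Rational.Solver using (module +-*-Solver)
import Data.Rational.Unnormalised as ℚᵘ
import Data.Rational.Unnormalised.Properties as ℚᵘ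
open import Data.Sign as Sign using (Sign)
open import Data.Sum as Sum using (_⊎_; inj₁; inj₂; [_,_]′)
open import Data.Vec using (Vec; []; _∷_; lookup)
open import Function using (_∘_; id; Equivalence)
open import Relation.Binary.Definitions using (tri<; tri≈; tri>)
open import Relation.Binary.PropositionalEquality
open import Relation.Nullary using (¬_; Dec; yes; no; contradiction; ¬?)
open import Relation.Nullary.Decidable using (_×-dec_; _⊎-dec_; _→-dec_; from-yes; ⌊_⌋; True; toWitness; fromWitness; decidable-stable)
open import Defs

-- Separating segments by affine functionals

fromℤ-homo-+ : ∀ i j → fromℤ (i ℤ.+ j) ≡ fromℤ i ℚ.+ fromℤ j
fromℤ-homo-+ i j = ℚ.toℚᵘ-injective (ℚᵘ.≃-trans
  (ℚᵘ.*≡* (cong (ℤ._* ℤ.1ℤ) (sym (cong₂ ℤ._+_ (ℤ.*-identityʳ i) (ℤ.*-identityʳ j)))))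
  (ℚᵘ.≃-sym (ℚ.toℚᵘ-homo-+ (fromℤ i) (fromℤ j))))

fromℤ-homo-* : ∀ i j → fromℤ (i ℤ.* j) ≡ fromℤ i ℚ.* fromℤ j
fromℤ-homo-* i j = ℚ.toℚᵘ-injective (ℚᵘ.≃-trans (ℚᵘ.*≡* refl)
  (ℚᵘ.≃-sym (ℚ.toℚᵘ-homo-* (fromℤ i) (fromℤ j))))

fromℤ-homo-neg : ∀ i → fromℤ (ℤ.- i) ≡ ℚ.- fromℤ i
fromℤ-homo-neg ℤ.-[1+ _ ] = refl
fromℤ-homo-neg (+ 0)      = refl
fromℤ-homo-neg ℤ.+[1+ _ ] = refl

fromℤ-mono-≤ : ∀ {i j} → i ℤ.≤ j → fromℤ i ℚ.≤ fromℤ j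
fromℤ-mono-≤ {i} {j} i≤j =
  ℚ.*≤* (subst₂ ℤ._≤_ (sym (ℤ.*-identityʳ i)) (sym (ℤ.*-identityʳ j)) i≤j)

fromℤ-mono-< : ∀ {i j} → i ℤ.< j → fromℤ i ℚ.< fromℤ j
fromℤ-mono-< {i} {j} i<j =
  ℚ.*<* (subst₂ ℤ._<_ (sym (ℤ.*-identityʳ i)) (sym (ℤ.*-identityʳ j)) i<j)

Grid : Set
Grid = ℤ × ℤ

toPoint : Grid → Point
toPoint (x , y) = fromℤ x , fromℤ y

toPoint-injective : ∀ {p q} → toPoint p ≡ toPoint q → p ≡ q
toPoint-injective eq = cong₂ _,_ (cong (ℚ.↥_ ∘ proj₁) eq) (cong (ℚ.↥_ ∘ proj₂) eq)

-- (α , β , γ) stands for the affine functional (x , y) ↦ α x + β y + γ.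
Affine : Set
Affine = ℤ × ℤ × ℤ

eval : Affine → Grid → ℤ
eval (α , β , γ) (x , y) = α ℤ.* x ℤ.+ β ℤ.* y ℤ.+ γ

negate : Affine → Affine
negate (α , β , γ) = ℤ.- α , ℤ.- β , ℤ.- γ

evalℚ : Affine → Point → ℚ
evalℚ (α , β , γ) (x , y) = fromℤ α ℚ.* x ℚ.+ fromℤ β ℚ.* y ℚ.+ fromℤ γ

-- With this, every sign needed at a grid point is decided in integer arithmetic.
evalℚ-toPoint : ∀ ℓ p → evalℚ ℓ (toPoint p) ≡ fromℤ (eval ℓ p)
evalℚ-toPoint (α , β , γ) (x , y) = sym (begin
  fromℤ (α ℤ.* x ℤ.+ β ℤ.* y ℤ.+ γ)
    ≡⟨ fromℤ-homo-+ (α ℤ.* x ℤ.+ β ℤ.* y) γ ⟩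
  fromℤ (α ℤ.* x ℤ.+ β ℤ.* y) ℚ.+ fromℤ γ
    ≡⟨ cong (ℚ._+ fromℤ γ) (fromℤ-homo-+ (α ℤ.* x) (β ℤ.* y)) ⟩
  fromℤ (α ℤ.* x) ℚ.+ fromℤ (β ℤ.* y) ℚ.+ fromℤ γ
    ≡⟨ cong (ℚ._+ fromℤ γ) (cong₂ ℚ._+_ (fromℤ-homo-* α x) (fromℤ-homo-* β y)) ⟩
  fromℤ α ℚ.* fromℤ x ℚ.+ fromℤ β ℚ.* fromℤ y ℚ.+ fromℤ γ ∎)
  where open ≡-Reasoning

-- The weights 1 - t and t add up to 1, so the constant γ splits as well.
evalℚ-convex : ∀ ℓ {p q} t →
  evalℚ ℓ ((1ℚ ℚ.- t) ℚ.* proj₁ p ℚ.+ t ℚ.* proj₁ q ,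
           (1ℚ ℚ.- t) ℚ.* proj₂ p ℚ.+ t ℚ.* proj₂ q)
    ≡ (1ℚ ℚ.- t) ℚ.* evalℚ ℓ p ℚ.+ t ℚ.* evalℚ ℓ q
evalℚ-convex (α , β , γ) {p₁ , p₂} {q₁ , q₂} t = solve 8
  (λ α β γ p₁ p₂ q₁ q₂ t →
    α :* ((con 1ℚ :- t) :* p₁ :+ t :* q₁) :+ β :* ((con 1ℚ :- t) :* p₂ :+ t :* q₂) :+ γ
    := (con 1ℚ :- t) :* (α :* p₁ :+ β :* p₂ :+ γ) :+ t :* (α :* q₁ :+ β :* q₂ :+ γ))
  refl (fromℤ α) (fromℤ β) (fromℤ γ) p₁ p₂ q₁ q₂ t
  where open +-*-Solver

evalℚ-negate : ∀ ℓ z → evalℚ (negate ℓ) z ≡ ℚ.- evalℚ ℓ z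
evalℚ-negate (α , β , γ) (x , y)
  rewrite fromℤ-homo-neg α | fromℤ-homo-neg β | fromℤ-homo-neg γ = solve 5
    (λ α β γ x y → :- α :* x :+ :- β :* y :+ :- γ := :- (α :* x :+ β :* y :+ γ))
    refl (fromℤ α) (fromℤ β) (fromℤ γ) x y
  where open +-*-Solver

Segment : Set
Segment = Grid × Grid

Below : Affine → Segment → Set
Below ℓ (p , q) = eval ℓ p ℤ.≤ 0ℤ × eval ℓ q ℤ.≤ 0ℤ

StrictlyBelow : Affine → Segment → Set
StrictlyBelow ℓ (p , q) = Below ℓ (p , q) × (eval ℓ p ℤ.< 0ℤ ⊎ eval ℓ q ℤ.< 0ℤ)

below? : ∀ ℓ e → Dec (Below ℓ e)
below? ℓ (p , q) = eval ℓ p ℤ.≤? 0ℤ ×-dec eval ℓ q ℤ.≤? 0ℤ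

strictlyBelow? : ∀ ℓ e → Dec (StrictlyBelow ℓ e)
strictlyBelow? ℓ (p , q) =
  below? ℓ (p , q) ×-dec (eval ℓ p ℤ.<? 0ℤ ⊎-dec eval ℓ q ℤ.<? 0ℤ)

-- Not symmetric: f may lie in the separating line, while e can touch it only at one of its ends.
Separated : Segment → Segment → Set
Separated e f = ∃ λ ℓ → StrictlyBelow ℓ e × Below (negate ℓ) f

_∈ˢ_ : Point → Segment → Set
z ∈ˢ (p , q) = z ∈[ toPoint p , toPoint q ]

private
  0≤1-t : ∀ {t} → t ℚ.≤ 1ℚ → 0ℚ ℚ.≤ 1ℚ ℚ.- t
  0≤1-t {t} t≤1 = subst (ℚ._≤ 1ℚ ℚ.- t) (ℚ.+-inverseʳ t) (ℚ.+-monoˡ-≤ (ℚ.- t) t≤1)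

  nonNeg*≤0 : ∀ {s v} → 0ℚ ℚ.≤ s → v ℚ.≤ 0ℚ → s ℚ.* v ℚ.≤ 0ℚ
  nonNeg*≤0 {s} {v} 0≤s v≤0 = subst (s ℚ.* v ℚ.≤_) (ℚ.*-zeroʳ s)
    (ℚ.*-monoˡ-≤-nonNeg s {{ℚ.nonNegative 0≤s}} v≤0)

  sum-vanishes : ∀ {v w} → v ℚ.≤ 0ℚ → w ℚ.≤ 0ℚ → 0ℚ ℚ.≤ v ℚ.+ w → v ≡ 0ℚ
  sum-vanishes {v} {w} v≤0 w≤0 0≤v+w = ℚ.≤-antisym v≤0
    (ℚ.≤-trans 0≤v+w (subst (v ℚ.+ w ℚ.≤_) (ℚ.+-identityʳ v) (ℚ.+-monoʳ-≤ v w≤0)))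

  factor-vanishes : ∀ {s v} → 0ℚ ℚ.≤ s → v ℚ.< 0ℚ → s ℚ.* v ≡ 0ℚ → s ≡ 0ℚ
  factor-vanishes {s} {v} 0≤s v<0 sv≡0 = ℚ.≤-antisym
    (ℚ.*-cancelʳ-≤-neg v {{ℚ.negative v<0}}
      (ℚ.≤-reflexive (trans (ℚ.*-zeroˡ v) (sym sv≡0)))) 0≤s

  evalℚ-toPoint-≤0 : ∀ ℓ p → eval ℓ p ℤ.≤ 0ℤ → evalℚ ℓ (toPoint p) ℚ.≤ 0ℚ
  evalℚ-toPoint-≤0 ℓ p h = subst (ℚ._≤ 0ℚ) (sym (evalℚ-toPoint ℓ p)) (fromℤ-mono-≤ h)

  evalℚ-toPoint-<0 : ∀ ℓ p → eval ℓ p ℤ.< 0ℤ → evalℚ ℓ (toPoint p) ℚ.< 0ℚ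
  evalℚ-toPoint-<0 ℓ p h = subst (ℚ._< 0ℚ) (sym (evalℚ-toPoint ℓ p)) (fromℤ-mono-< h)

below⇒≤0 : ∀ ℓ e {z} → Below ℓ e → z ∈ˢ e → evalℚ ℓ z ℚ.≤ 0ℚ
below⇒≤0 ℓ (p , q) (p≤0 , q≤0) (t , 0≤t , t≤1 , refl , refl) =
  subst (ℚ._≤ 0ℚ) (sym (evalℚ-convex ℓ {toPoint p} {toPoint q} t))
    (ℚ.+-mono-≤ (nonNeg*≤0 (0≤1-t t≤1) (evalℚ-toPoint-≤0 ℓ p p≤0))
                (nonNeg*≤0 0≤t (evalℚ-toPoint-≤0 ℓ q q≤0)))

-- The value at z is a weighted sum of two values ≤ 0, yet it is ≥ 0, so both summands vanish. An
-- end with a strictly negative value thus has weight 0, and z is the other end.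
strictlyBelow⇒endpoint : ∀ ℓ p q {z} → StrictlyBelow ℓ (p , q) → z ∈ˢ (p , q) →
  0ℚ ℚ.≤ evalℚ ℓ z → z ≡ toPoint p ⊎ z ≡ toPoint q
strictlyBelow⇒endpoint ℓ p q {z} ((p≤0 , q≤0) , strict) (t , 0≤t , t≤1 , refl , refl) 0≤z
  with strict
... | inj₁ p<0 = inj₂ (cong₂ _,_ (at-q _ _) (at-q _ _))
  where
  1-t≡0 : 1ℚ ℚ.- t ≡ 0ℚ
  1-t≡0 = factor-vanishes (0≤1-t t≤1) (evalℚ-toPoint-<0 ℓ p p<0)
    (sum-vanishes (nonNeg*≤0 (0≤1-t t≤1) (evalℚ-toPoint-≤0 ℓ p p≤0))
                  (nonNeg*≤0 0≤t (evalℚ-toPoint-≤0 ℓ q q≤0))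
                  (subst (0ℚ ℚ.≤_) (evalℚ-convex ℓ {toPoint p} {toPoint q} t) 0≤z))
  at-q : ∀ a b → (1ℚ ℚ.- t) ℚ.* a ℚ.+ t ℚ.* b ≡ b
  at-q a b = trans
    (solve 3 (λ t a b → (con 1ℚ :- t) :* a :+ t :* b := b :+ (con 1ℚ :- t) :* (a :- b)) refl t a b)
    (trans (cong (λ s → b ℚ.+ s ℚ.* (a ℚ.- b)) 1-t≡0)
      (trans (cong (b ℚ.+_) (ℚ.*-zeroˡ (a ℚ.- b))) (ℚ.+-identityʳ b)))
    where open +-*-Solver
... | inj₂ q<0 = inj₁ (cong₂ _,_ (at-p _ _) (at-p _ _))
  where
  t≡0 : t ≡ 0ℚ
  t≡0 = factor-vanishes 0≤t (evalℚ-toPoint-<0 ℓ q q<0)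
    (sum-vanishes (nonNeg*≤0 0≤t (evalℚ-toPoint-≤0 ℓ q q≤0))
                  (nonNeg*≤0 (0≤1-t t≤1) (evalℚ-toPoint-≤0 ℓ p p≤0))
                  (subst (0ℚ ℚ.≤_) (trans (evalℚ-convex ℓ {toPoint p} {toPoint q} t)
                    (ℚ.+-comm ((1ℚ ℚ.- t) ℚ.* evalℚ ℓ (toPoint p)) _)) 0≤z))
  at-p : ∀ a b → (1ℚ ℚ.- t) ℚ.* a ℚ.+ t ℚ.* b ≡ a
  at-p a b = trans
    (solve 3 (λ t a b → (con 1ℚ :- t) :* a :+ t :* b := a :+ t :* (b :- a)) refl t a b)
    (trans (cong (λ s → a ℚ.+ s ℚ.* (b ℚ.- a)) t≡0)
      (trans (cong (a ℚ.+_) (ℚ.*-zeroˡ (b ℚ.- a))) (ℚ.+-identityʳ a)))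
    where open +-*-Solver

-- On f the functional is ≥ 0, so a common point lies on the separating line, which the first
-- segment touches only at an end.
separated⇒endpoint : ∀ p q f {z} → Separated (p , q) f → z ∈ˢ (p , q) → z ∈ˢ f →
  z ≡ toPoint p ⊎ z ≡ toPoint q
separated⇒endpoint p q f {z} (ℓ , below , above) z∈e z∈f =
  strictlyBelow⇒endpoint ℓ p q below z∈e
    (subst₂ ℚ._≤_ refl (ℚ-neg-involutive (evalℚ ℓ z))
      (ℚ.neg-antimono-≤ (subst (ℚ._≤ 0ℚ) (evalℚ-negate ℓ z) (below⇒≤0 (negate ℓ) f above z∈f))))
  where
  ℚ-neg-involutive : ∀ a → ℚ.- (ℚ.- a) ≡ a
  ℚ-neg-involutive = solve 1 (λ a → :- (:- a) := a) refl
    where open +-*-Solver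

negate-involutive : ∀ ℓ → negate (negate ℓ) ≡ ℓ
negate-involutive (α , β , γ) =
  cong₂ _,_ (ℤ.neg-involutive α) (cong₂ _,_ (ℤ.neg-involutive β) (ℤ.neg-involutive γ))

-- Neither segment lies in the line, so the line serves in either order, up to sign.
separated-both : ∀ ℓ e f → StrictlyBelow ℓ e → StrictlyBelow (negate ℓ) f →
  Separated e f × Separated f e
separated-both ℓ e f e-below f-above =
  (ℓ , e-below , proj₁ f-above) ,
  (negate ℓ , f-above , subst (λ m → Below m e) (sym (negate-involutive ℓ)) (proj₁ e-below))

start∈ : ∀ p q → p ∈[ p , q ]
start∈ (p₁ , p₂) (q₁ , q₂) = 0ℚ , ℚ.≤-refl , from-yes (0ℚ ℚ.≤? 1ℚ) , at-start p₁ q₁ , at-start p₂ q₂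
  where
  open +-*-Solver
  at-start : ∀ a b → a ≡ (1ℚ ℚ.- 0ℚ) ℚ.* a ℚ.+ 0ℚ ℚ.* b
  at-start = solve 2 (λ a b → a := (con 1ℚ :- con 0ℚ) :* a :+ con 0ℚ :* b) refl

end∈ : ∀ p q → q ∈[ p , q ]
end∈ (p₁ , p₂) (q₁ , q₂) = 1ℚ , from-yes (0ℚ ℚ.≤? 1ℚ) , ℚ.≤-refl , at-end p₁ q₁ , at-end p₂ q₂
  where
  open +-*-Solver
  at-end : ∀ a b → b ≡ (1ℚ ℚ.- 1ℚ) ℚ.* a ℚ.+ 1ℚ ℚ.* b
  at-end = solve 2 (λ a b → b := (con 1ℚ :- con 1ℚ) :* a :+ con 1ℚ :* b) refl

-- The graph

-- top and bot belong to all gadgets and also name the first two vertices of the whole graph.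
pattern top = zero
pattern bot = suc top
pattern u₁  = suc bot
pattern w₁  = suc u₁
pattern v₁  = suc w₁
pattern r₁  = suc v₁
pattern s₁  = suc r₁
pattern s₂  = suc s₁
pattern s₃  = suc s₂
pattern s₄  = suc s₃
pattern r₂  = suc s₄
pattern w₂  = suc r₂
pattern v₂  = suc w₂
pattern u₂  = suc v₂

Role : Set
Role = Fin 14

gadgetEdges : List (Role × Role)
gadgetEdges =
  (top , u₁) ∷ (top , w₁) ∷ (top , r₁) ∷ (top , s₁) ∷
  (top , s₄) ∷ (top , r₂) ∷ (top , w₂) ∷ (top , u₂) ∷
  (bot , u₁) ∷ (bot , v₁) ∷ (bot , r₁) ∷ (bot , s₂) ∷
  (bot , s₃) ∷ (bot , r₂) ∷ (bot , v₂) ∷ (bot , u₂) ∷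
  (u₁ , w₁) ∷ (u₁ , v₁) ∷ (w₁ , v₁) ∷ (w₁ , r₁) ∷ (v₁ , r₁) ∷
  (r₁ , s₁) ∷ (r₁ , s₂) ∷ (s₁ , s₂) ∷ (s₂ , s₃) ∷
  (s₃ , s₄) ∷ (s₁ , s₄) ∷ (s₃ , r₂) ∷ (s₄ , r₂) ∷
  (r₂ , w₂) ∷ (r₂ , v₂) ∷ (w₂ , v₂) ∷ (w₂ , u₂) ∷ (v₂ , u₂) ∷ []

Gadget : Set
Gadget = Fin 16

order : ℕ
order = 2 ℕ.+ 16 ℕ.* 12

vertex : Gadget → Role → Fin order
vertex g top           = top
vertex g bot           = bot
vertex g (suc (suc j)) = 2 ↑ʳ combine g j

-- `top` and `bot` lie in all gadgets; gadget `zero` is an arbitrary representative.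
locate : Fin order → Gadget × Role
locate top           = zero , top
locate bot           = zero , bot
locate (suc (suc w)) = map₂ (2 ↑ʳ_) (remQuot {16} 12 w)

vertex-locate : ∀ v → uncurry vertex (locate v) ≡ v
vertex-locate zero          = refl
vertex-locate (suc zero)    = refl
vertex-locate (suc (suc w)) = cong (2 ↑ʳ_) (Fin.combine-remQuot {16} 12 w)

locate-inner : ∀ g j → locate (vertex g (suc (suc j))) ≡ (g , suc (suc j))
locate-inner g j = cong (map₂ (2 ↑ʳ_)) (Fin.remQuot-combine {16} {12} g j)

glue : ∀ {a} {A : Set a} → (Gadget → Role → A) → Fin order → A
glue f v = uncurry f (locate v)

-- `glue` reads `top` and `bot` in gadget `zero`, so the other gadgets have to agree with it there.
glue-vertex : ∀ {a} {A : Set a} (f : Gadget → Role → A) →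
  (∀ g → f g top ≡ f zero top) → (∀ g → f g bot ≡ f zero bot) →
  ∀ g i → glue f (vertex g i) ≡ f g i
glue-vertex f f-top f-bot g top           = sym (f-top g)
glue-vertex f f-top f-bot g bot           = sym (f-bot g)
glue-vertex f f-top f-bot g (suc (suc j)) = cong (uncurry f) (locate-inner g j)

embed : Gadget → Role × Role → Fin order × Fin order
embed g (i , j) = vertex g i , vertex g j

open DecMembership (≡-dec (Fin._≟_ {order}) (Fin._≟_ {order})) using () renaming (_∈?_ to _∈ᴳ?_)

opaque
  edges : List (Fin order × Fin order)
  edges = cartesianProductWith embed (allFin 16) gadgetEdges

  ∈-edges⁺ : ∀ g {ij} → ij ∈ gadgetEdges → embed g ij ∈ edges
  ∈-edges⁺ g = ∈-cartesianProductWith⁺ embed {allFin 16} {gadgetEdges} (∈-allFin g)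

  ∈-edges⁻ : ∀ {e} → e ∈ edges → ∃₂ λ g ij → ij ∈ gadgetEdges × e ≡ embed g ij
  ∈-edges⁻ e∈ with ∈-cartesianProductWith⁻ embed (allFin 16) gadgetEdges e∈
  ... | g , ij , _ , ij∈ , e≡ = g , ij , ij∈ , e≡

opaque
  -- The roles are numbered so that this holds. It excludes loops and makes the listed orientation
  -- the one stored in an `Edge`.
  vertex-increasing : ∀ g → All (λ (i , j) → vertex g i Fin.< vertex g j) gadgetEdges
  vertex-increasing = from-yes (Fin.all? λ g →
    All.all? (λ (i , j) → vertex g i Fin.<? vertex g j) gadgetEdges)

∈-edges⇒< : ∀ {u v} → (u , v) ∈ edges → u Fin.< v
∈-edges⇒< e∈ with ∈-edges⁻ e∈
... | g , _ , ij∈ , refl = All.lookup (vertex-increasing g) ij∈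

adj : Fin order → Fin order → Bool
adj u v = ⌊ (u , v) ∈ᴳ? edges ⌋ ∨ ⌊ (v , u) ∈ᴳ? edges ⌋

adj⇒∈ : ∀ {u v} → T (adj u v) → (u , v) ∈ edges ⊎ (v , u) ∈ edges
adj⇒∈ {u} {v} = Sum.map (toWitness {a? = (u , v) ∈ᴳ? edges}) (toWitness {a? = (v , u) ∈ᴳ? edges})
  ∘ Equivalence.to (T-∨ {⌊ (u , v) ∈ᴳ? edges ⌋})

∈⇒adj : ∀ {u v} → (u , v) ∈ edges ⊎ (v , u) ∈ edges → T (adj u v)
∈⇒adj {u} {v} = Equivalence.from (T-∨ {⌊ (u , v) ∈ᴳ? edges ⌋})
  ∘ Sum.map (fromWitness {a? = (u , v) ∈ᴳ? edges}) (fromWitness {a? = (v , u) ∈ᴳ? edges})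

G : Graph
G = record
  { order  = order
  ; adj    = adj
  ; sym    = λ _ _ t → ∈⇒adj (Sum.swap (adj⇒∈ t))
  ; irrefl = λ v t → Fin.<-irrefl refl (∈-edges⇒< ([ id , id ]′ (adj⇒∈ t)))
  }

record Origin (e : Edge G) : Set where
  constructor origin
  field
    gadget      : Gadget
    {start end} : Role
    local       : (start , end) ∈ gadgetEdges
    src≡        : Edge.src e ≡ vertex gadget start
    tgt≡        : Edge.tgt e ≡ vertex gadget end

edge-origin : ∀ e → Origin e
edge-origin e with adj⇒∈ (Edge.isEdge e)
... | inj₂ e∈ = contradiction (∈-edges⇒< e∈) (Fin.<-asym (Edge.src<tgt e))
... | inj₁ e∈ with ∈-edges⁻ e∈
... | g , _ , ij∈ , eq = origin g ij∈ (cong proj₁ eq) (cong proj₂ eq)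

gadgetEdge : ∀ g {i j} → (i , j) ∈ gadgetEdges → Edge G
gadgetEdge g {i} {j} ij∈ = record
  { src     = vertex g i
  ; tgt     = vertex g j
  ; src<tgt = All.lookup (vertex-increasing g) ij∈
  ; isEdge  = ∈⇒adj (inj₁ (∈-edges⁺ g ij∈))
  }

Edge-≡ : ∀ {e f : Edge G} → Edge.src e ≡ Edge.src f → Edge.tgt e ≡ Edge.tgt f → e ≡ f
Edge-≡ {record {src<tgt = p ; isEdge = s}} {record {src<tgt = q ; isEdge = t}} refl refl
  rewrite Fin.<-irrelevant p q | T-irrelevant s t = refl

-- The drawing

-- At y = ±2, a line from `top` or `bot` to (10h , 0) with h ≤ 15 has drifted from x = 10h by 10h ·
-- 2/400 ≤ 3/4, while the vertices with y = ±2 keep distance 2 from it.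
height : ℤ
height = + 400

-- Listed from `u₁` on. A gadget is symmetric about its vertical line at offset 5; neighbours of
-- `top` have y ≥ 0, those of `bot` have y ≤ 0.
offset : Vec (ℕ × ℤ) 12
offset =
  (1 , + 0) ∷ (2 , + 2) ∷ (2 , ℤ.- + 2) ∷ (3 , + 0) ∷
  (4 , + 1) ∷ (4 , ℤ.- + 1) ∷ (6 , ℤ.- + 1) ∷ (6 , + 1) ∷
  (7 , + 0) ∷ (8 , + 2) ∷ (8 , ℤ.- + 2) ∷ (9 , + 0) ∷ []

-- The gadgets stand side by side around the x-axis, with top and bot so far away that the lines
-- to them are nearly vertical inside a gadget.
coord : Gadget → Role → Grid
coord g top           = 0ℤ , height
coord g bot           = 0ℤ , ℤ.- height
coord g (suc (suc j)) = + (10 ℕ.* toℕ g ℕ.+ proj₁ (lookup offset j)) , proj₂ (lookup offset j)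

place : Gadget → Role × Role → Segment
place g (i , j) = coord g i , coord g j

-- Its value is twice the signed area of the triangle formed with the two given points, so swapping
-- them flips the sign.
line : Grid → Grid → Affine
line (x , y) (x′ , y′) = y ℤ.- y′ , x′ ℤ.- x , x ℤ.* y′ ℤ.- x′ ℤ.* y

parallel : Segment → Grid → Affine
parallel (p , q) r = let (α , β , γ) = line p q in α , β , γ ℤ.- eval (line p q) r

-- If two non-collinear segments do not cross, one of them lies on one side of the line through
-- the other; so the line through f, or a parallel to e through an end of f, separates e from f.
candidates : Segment → Segment → List Affine
candidates e (r , s) =
  line r s ∷ line s r ∷
  parallel e r ∷ negate (parallel e r) ∷ parallel e s ∷ negate (parallel e s) ∷ []

SeparatedByCandidate : Segment → Segment → Set
SeparatedByCandidate e f =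
  Any (λ ℓ → StrictlyBelow ℓ e × Below (negate ℓ) f) (candidates e f)

separatedByCandidate? : ∀ e f → Dec (SeparatedByCandidate e f)
separatedByCandidate? e f =
  Any.any? (λ ℓ → strictlyBelow? ℓ e ×-dec below? (negate ℓ) f) (candidates e f)

opaque
  -- Decided for each gadget anew: the gadgets are translates of one another only away from `top`
  -- and `bot`.
  same-gadget : ∀ g → All (λ e → All (λ f →
    e ≡ f ⊎ SeparatedByCandidate (place g e) (place g f)) gadgetEdges) gadgetEdges
  same-gadget = from-yes (Fin.all? λ g → All.all? (λ e → All.all? (λ f →
    ≡-dec Fin._≟_ Fin._≟_ e f ⊎-dec separatedByCandidate? (place g e) (place g f))
    gadgetEdges) gadgetEdges)

boundary : Gadget → Grid
boundary h = + (10 ℕ.* toℕ h) , 0ℤ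

-- The two sides of the angle top – boundary h – bot, which has the gadgets before h on its convex
-- side.
upper lower : Gadget → Affine
upper h = line (0ℤ , height) (boundary h)
lower h = line (boundary h) (0ℤ , ℤ.- height)

opaque
  left-of : ∀ g h → g Fin.< h → All (λ e →
    StrictlyBelow (upper h) (place g e) × StrictlyBelow (lower h) (place g e)) gadgetEdges
  left-of = from-yes (Fin.all? λ g → Fin.all? λ h → g Fin.<? h →-dec All.all? (λ e →
    strictlyBelow? (upper h) (place g e) ×-dec strictlyBelow? (lower h) (place g e)) gadgetEdges)

  -- The reflex side of the angle is only a union of two half-planes: an edge at `top` lies beyond
  -- `upper`, an edge at `bot` beyond `lower`.
  right-of : ∀ h → All (λ e →
    StrictlyBelow (negate (upper h)) (place h e) ⊎ StrictlyBelow (negate (lower h)) (place h e))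
    gadgetEdges
  right-of = from-yes (Fin.all? λ h → All.all? (λ e →
    strictlyBelow? (negate (upper h)) (place h e) ⊎-dec
    strictlyBelow? (negate (lower h)) (place h e)) gadgetEdges)

separated-across : ∀ {g h e f} → g Fin.< h → e ∈ gadgetEdges → f ∈ gadgetEdges →
  Separated (place g e) (place h f) × Separated (place h f) (place g e)
separated-across {g} {h} {e} {f} g<h e∈ f∈
  with left-upper , left-lower ← All.lookup (left-of g h g<h) e∈
  with All.lookup (right-of h) f∈
... | inj₁ right = separated-both (upper h) (place g e) (place h f) left-upper right
... | inj₂ right = separated-both (lower h) (place g e) (place h f) left-lower right

separated : ∀ {g h e f} → e ∈ gadgetEdges → f ∈ gadgetEdges → (g , e) ≢ (h , f) →
  Separated (place g e) (place h f)
separated {g} {h} e∈ f∈ ge≢hf with Fin.<-cmp g h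
... | tri< g<h _ _ = proj₁ (separated-across g<h e∈ f∈)
... | tri> _ _ h<g = proj₂ (separated-across h<g f∈ e∈)
... | tri≈ _ refl _ with All.lookup (All.lookup (same-gadget g) e∈) f∈
...   | inj₁ refl = contradiction refl ge≢hf
...   | inj₂ found = Any.satisfied found

-- The plane drawing from separated edges

opaque
  coord-injective : ∀ g i h j → coord g i ≡ coord h j → vertex g i ≡ vertex h j
  coord-injective = from-yes (Fin.all? λ g → Fin.all? λ i → Fin.all? λ h → Fin.all? λ j →
    ≡-dec ℤ._≟_ ℤ._≟_ (coord g i) (coord h j) →-dec vertex g i Fin.≟ vertex h j)

pos : Fin order → Point
pos = toPoint ∘ glue coord

pos-vertex : ∀ g i → pos (vertex g i) ≡ toPoint (coord g i)
pos-vertex g i = cong toPoint (glue-vertex coord (λ _ → refl) (λ _ → refl) g i)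

pos-injective : ∀ {u v} → pos u ≡ pos v → u ≡ v
pos-injective {u} {v} eq = trans (sym (vertex-locate u)) (trans
  (uncurry (uncurry coord-injective (locate u)) (locate v) (toPoint-injective eq)) (vertex-locate v))

opaque
  -- No vertex is isolated, so a vertex inside an edge would be a crossing with one of its own
  -- edges.
  incident : ∀ i → Any (λ (j , k) → i ≡ j ⊎ i ≡ k) gadgetEdges
  incident = from-yes (Fin.all? λ i → Any.any? (λ (j , k) → i Fin.≟ j ⊎-dec i Fin.≟ k) gadgetEdges)

pos-src : ∀ {e} (o : Origin e) → pos (Edge.src e) ≡ toPoint (coord (Origin.gadget o) (Origin.start o))
pos-src (origin g {i} _ src≡ _) = trans (cong pos src≡) (pos-vertex g i)

pos-tgt : ∀ {e} (o : Origin e) → pos (Edge.tgt e) ≡ toPoint (coord (Origin.gadget o) (Origin.end o))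
pos-tgt (origin g {_} {j} _ _ tgt≡) = trans (cong pos tgt≡) (pos-vertex g j)

arcs-meet-at-ends : ∀ e f → e ≢ f → ∀ z → let open Edge in
  z ∈[ pos (src e) , pos (tgt e) ] → z ∈[ pos (src f) , pos (tgt f) ] →
  z ≡ pos (src e) ⊎ z ≡ pos (tgt e)
arcs-meet-at-ends e f e≢f z z∈e z∈f =
  Sum.map (λ z≡ → trans z≡ (sym (pos-src o))) (λ z≡ → trans z≡ (sym (pos-tgt o)))
    (separated⇒endpoint _ _ (place (gadget o′) (start o′ , end o′))
      (separated (local o) (local o′) distinct)
      (subst₂ (z ∈[_,_]) (pos-src o) (pos-tgt o) z∈e)
      (subst₂ (z ∈[_,_]) (pos-src o′) (pos-tgt o′) z∈f))
  where
  open Origin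
  o  = edge-origin e
  o′ = edge-origin f

  distinct : (gadget o , start o , end o) ≢ (gadget o′ , start o′ , end o′)
  distinct eq = e≢f (Edge-≡
    (trans (src≡ o) (trans (cong (λ (g , i , _) → vertex g i) eq) (sym (src≡ o′))))
    (trans (tgt≡ o) (trans (cong (λ (g , _ , j) → vertex g j) eq) (sym (tgt≡ o′)))))

planar : Planar G
planar = record
  { pos              = pos
  ; pos-inj          = pos-injective
  ; arc              = λ e → segment (pos (src e)) (pos (tgt e))
  ; isArc            = λ e eq → Fin.<⇒≢ (src<tgt e) (pos-injective eq)
  ; no-vertex-inside = vertex-outside
  ; no-crossing      = no-crossing
  }
  where
  open Edge

  no-crossing : ∀ e f → e ≢ f → ∀ z →
    z ∈[ pos (src e) , pos (tgt e) ] × z ≢ pos (src e) × z ≢ pos (tgt e) →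
    ¬ z ∈[ pos (src f) , pos (tgt f) ]
  no-crossing e f e≢f z (z∈e , z≢src , z≢tgt) z∈f =
    [ z≢src , z≢tgt ]′ (arcs-meet-at-ends e f e≢f z z∈e z∈f)

  incident-edge : ∀ v → ∃ λ f → v ≡ src f ⊎ v ≡ tgt f
  incident-edge v with find (incident (proj₂ (locate v)))
  ... | _ , jk∈ , i≡ = gadgetEdge (proj₁ (locate v)) jk∈ , Sum.map to-v to-v i≡
    where
    to-v : ∀ {j} → proj₂ (locate v) ≡ j → v ≡ vertex (proj₁ (locate v)) j
    to-v i≡j = trans (sym (vertex-locate v)) (cong (vertex (proj₁ (locate v))) i≡j)

  vertex-outside : ∀ e v →
    ¬ (pos v ∈[ pos (src e) , pos (tgt e) ] × pos v ≢ pos (src e) × pos v ≢ pos (tgt e))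
  vertex-outside e v inside@(_ , v≢src , v≢tgt) with incident-edge v
  -- If f were e, then v would be an end of e.
  ... | f , inj₁ refl = no-crossing e f (λ where refl → v≢src refl) _ inside (start∈ _ _)
  ... | f , inj₂ refl = no-crossing e f (λ where refl → v≢tgt refl) _ inside (end∈ _ _)

-- Unsigned list colourings

open DecMembership ℤ._≟_ using (_∈?_)
open DecUnique ℤ._≟_ using (unique?)

lookup-distinct : ∀ {xs : List ℤ} → Unique xs → ∀ {i j} → i Fin.< j →
  List.lookup xs i ≢ List.lookup xs j
lookup-distinct {_ ∷ xs} (x∉ ∷ _)  {zero}  {suc j} _         = All.lookup x∉ (∈-lookup {xs = xs} j)
lookup-distinct          (_ ∷ xs!) {suc _} {suc _} (s≤s i<j) = lookup-distinct xs! i<j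

-- Otherwise two positions of `xs` are sent to the same position of `ys`, against uniqueness.
covered⇒length≤ : ∀ {xs ys : List ℤ} → Unique xs →
  (∀ i → List.lookup xs i ∈ ys) → length xs ℕ.≤ length ys
covered⇒length≤ {xs} {ys} xs! covered = ℕ.≮⇒≥ λ |ys|<|xs| →
  let i , j , i<j , eq = Fin.pigeonhole |ys|<|xs| (λ i → Any.index (covered i)) in
  lookup-distinct xs! i<j (trans (lookup-index (covered i))
    (trans (cong (List.lookup ys) eq) (sym (lookup-index (covered j)))))

⊆-or-witness : ∀ xs ys → (∃ λ (z : ℤ) → z ∈ xs × z ∉ ys) ⊎ (∀ {z} → z ∈ xs → z ∈ ys)
⊆-or-witness xs ys with Any.any? (λ z → ¬? (z ∈? ys)) xs
... | yes found = inj₁ (find found)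
... | no  none  = inj₂ λ z∈ → decidable-stable (_ ∈? ys) (λ z∉ → none (lose z∈ z∉))

avoid : ∀ {xs} → Unique xs → ∀ ys → length ys ℕ.< length xs → ∃ λ z → z ∈ xs × z ∉ ys
avoid {xs} xs! ys |ys|<|xs| with ⊆-or-witness xs ys
... | inj₁ found = found
... | inj₂ xs⊆ys = contradiction (covered⇒length≤ xs! (λ i → xs⊆ys (∈-lookup i))) (ℕ.<⇒≱ |ys|<|xs|)

Four : List ℤ → Set
Four xs = Unique xs × length xs ≡ 4

-- With only two colours to exclude, one of them is passed twice.
pick : ∀ {xs} → Four xs → ∀ a b c → ∃ λ z → z ∈ xs × z ≢ a × z ≢ b × z ≢ c
pick (xs! , |xs|≡4) a b c
  with z , z∈ , z∉ ← avoid xs! (a ∷ b ∷ c ∷ []) (ℕ.≤-reflexive (sym |xs|≡4))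
  = z , z∈ , (λ z≡ → z∉ (here z≡)) , (λ z≡ → z∉ (there (here z≡))) ,
    (λ z≡ → z∉ (there (there (here z≡))))

-- All edges of the octahedron except the one between `top` and `bot`. Its antipodal pairs are r and
-- u, a and v, b and w.
record OctahedronColouring (R U V W : List ℤ) (a b : ℤ) : Set where
  field
    {r u v w} : ℤ
    r∈ : r ∈ R
    u∈ : u ∈ U
    v∈ : v ∈ V
    w∈ : w ∈ W
    a≢r : a ≢ r
    b≢r : b ≢ r
    a≢u : a ≢ u
    b≢u : b ≢ u
    a≢w : a ≢ w
    b≢v : b ≢ v
    u≢w : u ≢ w
    u≢v : u ≢ v
    w≢v : w ≢ v
    w≢r : w ≢ r
    v≢r : v ≢ r

-- Two colours p, q are reserved for r; w avoids both, and v rules out at most one of them.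
octahedron : ∀ {R U V W} → Four R → Four U → Four V → Four W → ∀ a b →
  OctahedronColouring R U V W a b
octahedron {R} fR fU fV fW a b
  with p , p∈ , p≢a , p≢b , _   ← pick fR a b b
  with q , q∈ , q≢a , q≢b , q≢p ← pick fR a b p
  with w , w∈ , w≢a , w≢p , w≢q ← pick fW a p q
  with u , u∈ , u≢a , u≢b , u≢w ← pick fU a b w
  with v , v∈ , v≢b , v≢w , v≢u ← pick fV b w u
  = let r , r∈ , r≢a , r≢b , w≢r , v≢r = choose-r in record
    { r∈ = r∈ ; u∈ = u∈ ; v∈ = v∈ ; w∈ = w∈ ; a≢r = ≢-sym r≢a ; b≢r = ≢-sym r≢b
    ; a≢u = ≢-sym u≢a ; b≢u = ≢-sym u≢b ; a≢w = ≢-sym w≢a ; b≢v = ≢-sym v≢b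
    ; u≢w = u≢w ; u≢v = ≢-sym v≢u ; w≢v = ≢-sym v≢w ; w≢r = w≢r ; v≢r = v≢r }
  where
  choose-r : ∃ λ r → r ∈ R × r ≢ a × r ≢ b × w ≢ r × v ≢ r
  choose-r with v ℤ.≟ p
  ... | yes refl = q , q∈ , q≢a , q≢b , w≢q , ≢-sym q≢p
  ... | no v≢p   = p , p∈ , p≢a , p≢b , w≢p , v≢p

Two : List ℤ → Set
Two xs = Unique xs × length xs ≡ 2

record SquareColouring (A B C D : List ℤ) : Set where
  field
    {a b c d} : ℤ
    a∈ : a ∈ A
    b∈ : b ∈ B
    c∈ : c ∈ C
    d∈ : d ∈ D
    a≢b : a ≢ b
    b≢c : b ≢ c
    c≢d : c ≢ d
    a≢d : a ≢ d

rotate : ∀ {A B C D} → SquareColouring B C D A → SquareColouring A B C D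
rotate s = record
  { a∈ = d∈ ; b∈ = a∈ ; c∈ = b∈ ; d∈ = c∈
  ; a≢b = ≢-sym a≢d ; b≢c = a≢b ; c≢d = b≢c ; a≢d = ≢-sym c≢d }
  where open SquareColouring s

avoid-one : ∀ {xs} → Two xs → ∀ y → ∃ λ z → z ∈ xs × y ≢ z
avoid-one (xs! , |xs|≡2) y with z , z∈ , z∉ ← avoid xs! (y ∷ []) (ℕ.≤-reflexive (sym |xs|≡2))
  = z , z∈ , λ y≡z → z∉ (here (sym y≡z))

-- In the order a, d, c, b each choice avoids just the preceding colour; the closing edge ab is safe
-- because z is missing from `B`.
square-from : ∀ {A B C D z} → Two B → Two C → Two D → z ∈ A → z ∉ B → SquareColouring A B C D
square-from {z = z} tB tC tD z∈A z∉B
  with d , d∈ , z≢d ← avoid-one tD z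
  with c , c∈ , d≢c ← avoid-one tC d
  with b , b∈ , c≢b ← avoid-one tB c
  = record { a∈ = z∈A ; b∈ = b∈ ; c∈ = c∈ ; d∈ = d∈ ; a≢b = λ where refl → z∉B b∈
           ; b≢c = ≢-sym c≢b ; c≢d = ≢-sym d≢c ; a≢d = z≢d }

-- Unless the four lists coincide, some colour of a vertex is missing at the next one; start
-- there and go round the other way.
square : ∀ {A B C D} → Two A → Two B → Two C → Two D → SquareColouring A B C D
square {A} {B} {C} {D} tA tB tC tD with ⊆-or-witness A B | ⊆-or-witness B C | ⊆-or-witness C D
... | inj₁ (_ , z∈ , z∉) | _ | _ = square-from tB tC tD z∈ z∉
... | inj₂ _ | inj₁ (_ , z∈ , z∉) | _ = rotate (square-from tC tD tA z∈ z∉)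
... | inj₂ _ | inj₂ _ | inj₁ (_ , z∈ , z∉) = rotate (rotate (square-from tD tA tB z∈ z∉))
-- All four lists contain p and q, which alternate around the even cycle.
square {p ∷ q ∷ []} ((p≢q ∷ []) ∷ _ , refl) _ _ _ | inj₂ A⊆B | inj₂ B⊆C | inj₂ C⊆D = record
  { a∈ = here refl ; b∈ = A⊆B (there (here refl)) ; c∈ = B⊆C (A⊆B (here refl))
  ; d∈ = C⊆D (B⊆C (A⊆B (there (here refl))))
  ; a≢b = p≢q ; b≢c = ≢-sym p≢q ; c≢d = p≢q ; a≢d = p≢q }

residue : ∀ {xs} → Four xs → ∀ a b →
  ∃ λ ys → Two ys × (∀ {z} → z ∈ ys → z ∈ xs × a ≢ z × b ≢ z)
residue f a b
  with p , p∈ , p≢a , p≢b , _   ← pick f a b b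
  with q , q∈ , q≢a , q≢b , q≢p ← pick f a b p
  = p ∷ q ∷ [] , ((≢-sym q≢p ∷ []) ∷ [] ∷ [] , refl) , λ where
      (here refl)         → p∈ , ≢-sym p≢a , ≢-sym p≢b
      (there (here refl)) → q∈ , ≢-sym q≢a , ≢-sym q≢b

record AntiprismColouring (S T X Y : List ℤ) (a b p q : ℤ) : Set where
  field
    {s t x y} : ℤ
    s∈ : s ∈ S
    t∈ : t ∈ T
    x∈ : x ∈ X
    y∈ : y ∈ Y
    a≢s : a ≢ s
    p≢s : p ≢ s
    b≢t : b ≢ t
    p≢t : p ≢ t
    b≢x : b ≢ x
    q≢x : q ≢ x
    a≢y : a ≢ y
    q≢y : q ≢ y
    s≢t : s ≢ t
    t≢x : t ≢ x
    x≢y : x ≢ y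
    s≢y : s ≢ y

antiprism : ∀ {S T X Y} → Four S → Four T → Four X → Four Y → ∀ a b p q →
  AntiprismColouring S T X Y a b p q
antiprism fS fT fX fY a b p q
  with _ , tS , S⊆ ← residue fS a p
  with _ , tT , T⊆ ← residue fT b p
  with _ , tX , X⊆ ← residue fX b q
  with _ , tY , Y⊆ ← residue fY a q
  with record { a∈ = s∈ ; b∈ = t∈ ; c∈ = x∈ ; d∈ = y∈
              ; a≢b = s≢t ; b≢c = t≢x ; c≢d = x≢y ; a≢d = s≢y } ← square tS tT tX tY
  with s∈S , a≢s , p≢s ← S⊆ s∈
  with t∈T , b≢t , p≢t ← T⊆ t∈
  with x∈X , b≢x , q≢x ← X⊆ x∈
  with y∈Y , a≢y , q≢y ← Y⊆ y∈
  = record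
    { s∈ = s∈S ; t∈ = t∈T ; x∈ = x∈X ; y∈ = y∈Y
    ; a≢s = a≢s ; p≢s = p≢s ; b≢t = b≢t ; p≢t = p≢t
    ; b≢x = b≢x ; q≢x = q≢x ; a≢y = a≢y ; q≢y = q≢y
    ; s≢t = s≢t ; t≢x = t≢x ; x≢y = x≢y ; s≢y = s≢y }

-- Colouring the gadgets and gluing

Extension : (Role → List ℤ) → ℤ → ℤ → Set
Extension L a b = ∃ λ (κ : Role → ℤ) →
  κ top ≡ a × κ bot ≡ b × (∀ i → κ i ∈ L i) × All (λ (i , j) → κ i ≢ κ j) gadgetEdges

assemble : ∀ L {a b} → a ∈ L top → b ∈ L bot →
  (left  : OctahedronColouring (L r₁) (L u₁) (L v₁) (L w₁) a b)
  (right : OctahedronColouring (L r₂) (L u₂) (L v₂) (L w₂) a b) →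
  AntiprismColouring (L s₁) (L s₂) (L s₃) (L s₄) a b
    (OctahedronColouring.r left) (OctahedronColouring.r right) →
  Extension L a b
assemble L {a} {b} a∈ b∈ left right middle = lookup colours , refl , refl , members ,
  -- In the order of `gadgetEdges`, which runs through the second octahedron from `r₂` to `u₂`;
  -- hence the reversals.
  (O.a≢u ∷ O.a≢w ∷ O.a≢r ∷ M.a≢s ∷ M.a≢y ∷ O′.a≢r ∷ O′.a≢w ∷ O′.a≢u ∷
   O.b≢u ∷ O.b≢v ∷ O.b≢r ∷ M.b≢t ∷ M.b≢x ∷ O′.b≢r ∷ O′.b≢v ∷ O′.b≢u ∷
   O.u≢w ∷ O.u≢v ∷ O.w≢v ∷ O.w≢r ∷ O.v≢r ∷
   M.p≢s ∷ M.p≢t ∷ M.s≢t ∷ M.t≢x ∷ M.x≢y ∷ M.s≢y ∷ ≢-sym M.q≢x ∷ ≢-sym M.q≢y ∷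
   ≢-sym O′.w≢r ∷ ≢-sym O′.v≢r ∷ O′.w≢v ∷ ≢-sym O′.u≢w ∷ ≢-sym O′.u≢v ∷ [])
  where
  module O  = OctahedronColouring left
  module O′ = OctahedronColouring right
  module M  = AntiprismColouring middle

  colours : Vec ℤ 14
  colours = a ∷ b ∷ O.u ∷ O.w ∷ O.v ∷ O.r ∷ M.s ∷ M.t ∷ M.x ∷ M.y ∷
    O′.r ∷ O′.w ∷ O′.v ∷ O′.u ∷ []

  members : ∀ i → lookup colours i ∈ L i
  members top = a∈
  members bot = b∈
  members u₁  = O.u∈
  members w₁  = O.w∈
  members v₁  = O.v∈
  members r₁  = O.r∈
  members s₁  = M.s∈
  members s₂  = M.t∈
  members s₃  = M.x∈
  members s₄  = M.y∈
  members r₂  = O′.r∈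
  members w₂  = O′.w∈
  members v₂  = O′.v∈
  members u₂  = O′.u∈

opaque
  extend : ∀ L → (∀ i → Four (L i)) → ∀ {a b} → a ∈ L top → b ∈ L bot → Extension L a b
  extend L four {a} {b} a∈ b∈ = assemble L a∈ b∈
    (octahedron (four r₁) (four u₁) (four v₁) (four w₁) a b)
    (octahedron (four r₂) (four u₂) (four v₂) (four w₂) a b)
    (antiprism (four s₁) (four s₂) (four s₃) (four s₄) a b _ _)

choosable : Choosable G 4
choosable L |L|≡4 = c , proper , from
  where
  open ListAssignment L

  four : ∀ v → Four (list v)
  four v = unique v , |L|≡4 v

  -- Nothing is to be avoided yet: any entry of the list will do.
  top-colour = avoid (unique top) [] (ℕ.≤-trans (s≤s z≤n) (ℕ.≤-reflexive (sym (|L|≡4 top))))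
  bot-colour = avoid (unique bot) [] (ℕ.≤-trans (s≤s z≤n) (ℕ.≤-reflexive (sym (|L|≡4 bot))))

  extension : ∀ g → Extension (list ∘ vertex g) (proj₁ top-colour) (proj₁ bot-colour)
  extension g = extend (list ∘ vertex g) (four ∘ vertex g)
    (proj₁ (proj₂ top-colour)) (proj₁ (proj₂ bot-colour))

  κ : Gadget → Role → ℤ
  κ g = proj₁ (extension g)

  c : Fin order → ℤ
  c = glue κ

  c-vertex : ∀ g i → c (vertex g i) ≡ κ g i
  -- All extensions have the prescribed colours at `top` and `bot`, hence agree there.
  c-vertex = glue-vertex κ
    (λ g → trans (proj₁ (proj₂ (extension g))) (sym (proj₁ (proj₂ (extension zero)))))
    (λ g → trans (proj₁ (proj₂ (proj₂ (extension g))))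
      (sym (proj₁ (proj₂ (proj₂ (extension zero))))))

  from : FromLists G L c
  from v = subst (λ u → c v ∈ list u) (vertex-locate v)
    (proj₁ (proj₂ (proj₂ (proj₂ (extension (proj₁ (locate v)))))) (proj₂ (locate v)))

  proper : UnsignedProperColoring G c
  proper e same with origin g {i} {j} ij∈ src≡ tgt≡ ← edge-origin e =
    All.lookup (proj₂ (proj₂ (proj₂ (proj₂ (extension g))))) ij∈
      (trans (sym (trans (cong c src≡) (c-vertex g i)))
        (trans same (trans (cong c tgt≡) (c-vertex g j))))

-- The signature and its bad lists

-- Disjoint from each other and from the colours ±9 and 10 to 13, so that the lists of `palette` are
-- free of duplicates.
topColours botColours : List ℤ
topColours = + 1 ∷ + 2 ∷ + 3 ∷ + 4 ∷ []
botColours = + 5 ∷ + 6 ∷ + 7 ∷ + 8 ∷ []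

targets : List (ℤ × ℤ)
targets = cartesianProduct topColours botColours

-- With a at `top` and b at `bot`, the colour 10 at an r would leave only 12 and 13 on its triangle,
-- and 11 at both leaves only 9 and -9 on the 4-cycle. Each inner list begins with the two colours
-- to be excluded by `last-two`.
palette : ℤ × ℤ → Role → List ℤ
palette (a , b) = lookup
  (topColours ∷ botColours ∷ u ∷ w ∷ v ∷ r ∷ sᵃ ∷ sᵇ ∷ sᵇ ∷ sᵃ ∷ r ∷ w ∷ v ∷ u ∷ [])
  where
  u w v r sᵃ sᵇ : List ℤ
  r  = a ∷ b ∷ + 10 ∷ + 11 ∷ []
  u  = a ∷ b ∷ + 12 ∷ + 13 ∷ []
  w  = a ∷ + 10 ∷ + 12 ∷ + 13 ∷ []
  v  = b ∷ + 10 ∷ + 12 ∷ + 13 ∷ []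
  sᵃ = a ∷ + 11 ∷ + 9 ∷ ℤ.- + 9 ∷ []
  sᵇ = b ∷ + 11 ∷ + 9 ∷ ℤ.- + 9 ∷ []

badList : Gadget → Role → List ℤ
badList g = palette (List.lookup targets g)

opaque
  badList-four : ∀ g i → Four (badList g i)
  badList-four = from-yes (Fin.all? λ g → Fin.all? λ i →
    unique? (badList g i) ×-dec length (badList g i) ℕ.≟ 4)

-- An `Edge` runs from its smaller to its larger vertex, so `s₂ s₁` does not occur.
sign : Role → Role → Sign
sign s₁ s₂ = Sign.-
sign _  _  = Sign.+

σ : Signature G
σ e = sign (proj₂ (locate (Edge.src e))) (proj₂ (locate (Edge.tgt e)))

-- At `top` and `bot` the gadget is lost, but the signature depends on the roles alone.
locate-role : ∀ g i → proj₂ (locate (vertex g i)) ≡ i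
locate-role g top           = refl
locate-role g bot           = refl
locate-role g (suc (suc j)) = cong proj₂ (locate-inner g j)

badLists : ListAssignment G
badLists = record
  { list     = glue badList
  ; unique   = λ v → proj₁ (uncurry badList-four (locate v))
  ; nonempty = λ v empty → contradiction
      (trans (sym (cong length empty)) (proj₂ (uncurry badList-four (locate v)))) λ ()
  }

-- The obstruction in one gadget

last-two : ∀ {p q s t z : ℤ} → z ∈ p ∷ q ∷ s ∷ t ∷ [] → p ≢ z → q ≢ z → z ≡ s ⊎ z ≡ t
last-two (here refl)                         p≢z _   = contradiction refl p≢z
last-two (there (here refl))                 _   q≢z = contradiction refl q≢z
last-two (there (there (here z≡s)))          _   _   = inj₁ z≡s
last-two (there (there (there (here z≡t)))) _   _   = inj₂ z≡t

two-colours-triangle : ∀ {s t x y z : ℤ} → x ≡ s ⊎ x ≡ t → y ≡ s ⊎ y ≡ t → z ≡ s ⊎ z ≡ t →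
  x ≢ y → y ≢ z → ¬ x ≢ z
two-colours-triangle (inj₁ refl) (inj₁ refl) _           x≢y _   _   = x≢y refl
two-colours-triangle (inj₂ refl) (inj₂ refl) _           x≢y _   _   = x≢y refl
two-colours-triangle (inj₁ refl) (inj₂ refl) (inj₁ refl) _   _   x≢z = x≢z refl
two-colours-triangle (inj₁ refl) (inj₂ refl) (inj₂ refl) _   y≢z _   = y≢z refl
two-colours-triangle (inj₂ refl) (inj₁ refl) (inj₁ refl) _   y≢z _   = y≢z refl
two-colours-triangle (inj₂ refl) (inj₁ refl) (inj₂ refl) _   _   x≢z = x≢z refl

-- Among ±k, the negative edge forces s = t; the other three edges then form a triangle coloured
-- with two colours.
unbalanced-square : ∀ {k s t x y : ℤ} →
  s ≡ k ⊎ s ≡ ℤ.- k → t ≡ k ⊎ t ≡ ℤ.- k → x ≡ k ⊎ x ≡ ℤ.- k → y ≡ k ⊎ y ≡ ℤ.- k →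
  s ≢ ℤ.- t → t ≢ x → x ≢ y → ¬ s ≢ y
unbalanced-square {k} (inj₁ refl) (inj₂ refl) _ _ s≢-t _ _ _ = s≢-t (sym (ℤ.neg-involutive k))
unbalanced-square     (inj₂ refl) (inj₁ refl) _ _ s≢-t _ _ _ = s≢-t refl
unbalanced-square     (inj₁ refl) (inj₁ refl) x∈ y∈ _ t≢x x≢y s≢y =
  two-colours-triangle (inj₁ refl) x∈ y∈ t≢x x≢y s≢y
unbalanced-square     (inj₂ refl) (inj₂ refl) x∈ y∈ _ t≢x x≢y s≢y =
  two-colours-triangle (inj₂ refl) x∈ y∈ t≢x x≢y s≢y

gadget-uncolourable : ∀ (κ : Role → ℤ) → (∀ i → κ i ∈ palette (κ top , κ bot) i) →
  ¬ (∀ {i j} → (i , j) ∈ gadgetEdges → κ i ≢ (sign i j ℤ.◃ 1) ℤ.* κ j)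
gadget-uncolourable κ κ∈ proper = unbalanced-square
  (last-two (κ∈ s₁) (top ≢⁺ s₁) (subst (_≢ κ s₁) r₁≡11 (r₁ ≢⁺ s₁)))
  (last-two (κ∈ s₂) (bot ≢⁺ s₂) (subst (_≢ κ s₂) r₁≡11 (r₁ ≢⁺ s₂)))
  (last-two (κ∈ s₃) (bot ≢⁺ s₃) (subst (_≢ κ s₃) r₂≡11 (≢-sym (s₃ ≢⁺ r₂))))
  (last-two (κ∈ s₄) (top ≢⁺ s₄) (subst (_≢ κ s₄) r₂≡11 (≢-sym (s₄ ≢⁺ r₂))))
  (λ s₁≡-s₂ → proper {s₁} {s₂} (from-yes ((s₁ , s₂) ∈ᴱ? gadgetEdges))
    (trans s₁≡-s₂ (sym (ℤ.-1*i≡-i (κ s₂)))))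
  (s₂ ≢⁺ s₃) (s₃ ≢⁺ s₄) (s₁ ≢⁺ s₄)
  where
  open DecMembership (≡-dec (Fin._≟_ {14}) (Fin._≟_ {14})) using ()
    renaming (_∈?_ to _∈ᴱ?_)

  -- On a positive edge the signed condition is the ordinary one. Evaluation supplies the implicit
  -- evidence that ij is such an edge.
  _≢⁺_ : ∀ i j → {True ((i , j) ∈ᴱ? gadgetEdges)} → {True (sign i j Sign.≟ Sign.+)} →
    κ i ≢ κ j
  (i ≢⁺ j) {ij∈} {positive} i≡j = proper (toWitness ij∈)
    (trans i≡j (trans (sym (ℤ.*-identityˡ (κ j)))
      (cong (λ s → (s ℤ.◃ 1) ℤ.* κ j) (sym (toWitness positive)))))

  -- If r were 10, the triangle u w v would have only 12 and 13 left.
  forced : ∀ {r u w v a b} →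
    r ∈ a ∷ b ∷ + 10 ∷ + 11 ∷ [] → u ∈ a ∷ b ∷ + 12 ∷ + 13 ∷ [] →
    w ∈ a ∷ + 10 ∷ + 12 ∷ + 13 ∷ [] → v ∈ b ∷ + 10 ∷ + 12 ∷ + 13 ∷ [] →
    a ≢ r → b ≢ r → a ≢ u → b ≢ u → a ≢ w → b ≢ v →
    r ≢ w → r ≢ v → u ≢ w → w ≢ v → u ≢ v → r ≡ + 11
  forced r∈ u∈ w∈ v∈ a≢r b≢r a≢u b≢u a≢w b≢v r≢w r≢v u≢w w≢v u≢v with last-two r∈ a≢r b≢r
  ... | inj₂ r≡11 = r≡11
  ... | inj₁ refl = contradiction u≢v (two-colours-triangle
    (last-two u∈ a≢u b≢u) (last-two w∈ a≢w r≢w) (last-two v∈ b≢v r≢v) u≢w w≢v)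

  r₁≡11 : κ r₁ ≡ + 11
  r₁≡11 = forced (κ∈ r₁) (κ∈ u₁) (κ∈ w₁) (κ∈ v₁)
    (top ≢⁺ r₁) (bot ≢⁺ r₁) (top ≢⁺ u₁) (bot ≢⁺ u₁) (top ≢⁺ w₁) (bot ≢⁺ v₁)
    (≢-sym (w₁ ≢⁺ r₁)) (≢-sym (v₁ ≢⁺ r₁)) (u₁ ≢⁺ w₁) (w₁ ≢⁺ v₁) (u₁ ≢⁺ v₁)

  r₂≡11 : κ r₂ ≡ + 11
  r₂≡11 = forced (κ∈ r₂) (κ∈ u₂) (κ∈ w₂) (κ∈ v₂)
    (top ≢⁺ r₂) (bot ≢⁺ r₂) (top ≢⁺ u₂) (bot ≢⁺ u₂) (top ≢⁺ w₂) (bot ≢⁺ v₂)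
    (r₂ ≢⁺ w₂) (r₂ ≢⁺ v₂) (≢-sym (w₂ ≢⁺ u₂)) (w₂ ≢⁺ v₂) (≢-sym (v₂ ≢⁺ u₂))

not-signed-choosable : ¬ SignedChoosable G σ 4
not-signed-choosable choose with choose badLists (λ v → proj₂ (uncurry badList-four (locate v)))
... | c , proper , from = gadget-uncolourable (c ∘ vertex g) in-palette local-proper
  where
  targeted : (c top , c bot) ∈ targets
  targeted = ∈-cartesianProduct⁺ (from top) (from bot)

  -- `targets` has 4 · 4 = 16 entries, so the position of the pair is itself a gadget.
  g : Gadget
  g = Any.index targeted

  in-palette : ∀ i → c (vertex g i) ∈ palette (c top , c bot) i
  -- The bad lists glue because those of `top` and `bot` are the same in all gadgets.
  in-palette i = subst (c (vertex g i) ∈_) (trans (glue-vertex badList (λ _ → refl) (λ _ → refl) g i)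
      (cong (λ t → palette t i) (sym (lookup-index targeted)))) (from (vertex g i))

  local-proper : ∀ {i j} → (i , j) ∈ gadgetEdges →
    c (vertex g i) ≢ (sign i j ℤ.◃ 1) ℤ.* c (vertex g j)
  local-proper {i} {j} ij∈ = subst (λ s → c (vertex g i) ≢ (s ℤ.◃ 1) ℤ.* c (vertex g j))
    (cong₂ sign (locate-role g i) (locate-role g j)) (proper (gadgetEdge g ij∈))

theorem2p3 : Σ Graph λ G → Planar G × Σ (Signature G) λ σ → (¬ SignedChoosable G σ 4) × Choosable G 4
theorem2p3 = G , planar , σ , not-signed-choosable , choosable
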